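{- Let $G$ be a connected graph with vertex set $\{u_1,\dots,u_n\}$, $n\ge2$, and let $\mathcal{H}=\{H_1,\dots,H_n\}$ be a family of graphs. Then $\dim_l(G\circ\mathcal{H})=\operatorname{adim}_l(G\circ\mathcal{H})$ if and only if $\varrho(G,\mathcal{H})=\varrho'(G,\mathcal{H})$.
   Context: All graphs are finite and simple with at least one vertex. $d_G$ is shortest-path distance ($+\infty$ between components), $d_{G,2}=\min\{d_G,2\}$; $s$ distinguishes $x,y$ w.r.t. $d$ if $d(s,x)\ne d(s,y)$. $\dim_l(G)$: minimum size of $S\subseteq V(G)$ such that any two adjacent vertices are distinguished w.r.t. $d_G$ by a vertex of $S$. $\operatorname{adim}_l(G)$: same with $d_{G,2}$ in place of $d_G$; minimum such sets are local adjacency bases. $\Phi$: edgeless graphs. $\mathcal{G}$: class of graphs $H$ such that every local adjacency basis $B$ of $H$ satisfies $B\subseteq N_H(v)$ for some $v$. True twins: $N[x]=N[y]$; let $U_1,\dots,U_k$ be the non-singleton true twin classes of $G$ and $T(G)=\bigcup_jU_j$. Lexicographic product $G\circ\mathcal{H}$: vertex set $\bigcup_i\{u_i\}\times V(H_i)$, $(u_i,v)\sim(u_j,w)$ iff $u_iu_j\in E(G)$, or $i=j$ and $vw\in E(H_i)$. $V_E=\{u_i\in V(G)-T(G): H_i\in\Phi\}$; $I=\{u_i: H_i\in\mathcal{G}\}$; for each $j$ with $I\cap U_j\ne\emptyset$ choose one vertex of $I\cap U_j$ and let $I'_j$ be the remaining vertices ($I'_j=\emptyset$ otherwise); $X_E=I-\bigcup_jI'_j$.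 Relation $\mathcal{R}$ (resp. $\mathcal{R}'$) on $X_E$: $u_i\sim u_j$ and $d_G(u,u_i)=d_G(u,u_j)$ (resp. $d_{G,2}(u,u_i)=d_{G,2}(u,u_j)$) for all $u\in V(G)-(V_E\cup\{u_i,u_j\})$. $\varrho(G,\mathcal{H})$ (resp. $\varrho'(G,\mathcal{H})$) is the minimum $|A|$ over $A\subseteq X_E$ such that every pair in $X_E$ satisfying $\mathcal{R}$ (resp. $\mathcal{R}'$) is distinguished by a vertex of $A$ w.r.t. $d_G$ (resp. $d_{G,2}$). -}

module Defs where

open import Data.Fin.Base using (Fin; zero; suc; toℕ; _<_; splitAt; _↑ˡ_; _↑ʳ_)
open import Data.Fin.Properties
  using (_≟_; any?; all?; pigeonhole; nonZeroIndex; splitAt-↑ˡ; splitAt-↑ʳ; join-splitAt)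
open import Data.Fin.Subset using (Subset; ⊤; _∈_; ∣_∣)
open import Data.Fin.Subset.Properties using (_∈?_; ∈⊤; anySubset?)
open import Data.List.Base using (tabulate)
open import Data.Nat.Base as ℕ using (ℕ; zero; suc; _+_; _∸_; _≤_; _⊓_; NonZero; z≤n; s≤s; z<s)
import Data.Nat.Properties as ℕ
open import Data.Nat.ListAction using (sum)
open import Data.Nat.Induction using (<-wellFounded)
open import Data.Product.Base using (Σ; ∃; _×_; _,_; proj₁; proj₂)
open import Data.Sum.Base using (_⊎_; inj₁; inj₂)
import Data.Vec.Base as Vec
open import Data.Vec.Properties using (lookup⇒[]=; []=⇒lookup; lookup∘tabulate)
open import Function.Base using (_∘_; _on_)
open import Function.Bundles using (_⇔_; mk⇔; Equivalence; _↔_; mk↔ₛ′; Inverse)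
open import Induction.WellFounded using (Acc; acc)
open import Level using (0ℓ)
open import Relation.Binary.Core using (Rel)
open import Relation.Binary.Definitions using (Symmetric; Irreflexive)
  renaming (Decidable to Decidable₂)
open import Relation.Binary.PropositionalEquality
  using (_≡_; _≢_; refl; sym; trans; cong; subst)
open import Relation.Nullary.Construct.Add.Supremum using (_⁺; ⊤⁺; [_]; ≡-dec; []-injective)
open import Relation.Nullary.Decidable
  using (Dec; yes; no; does; map′; ¬?; _×-dec_; _⊎-dec_; _→-dec_; decidable-stable; dec-true)
open import Relation.Nullary.Negation using (¬_; contradiction)
open import Relation.Unary using (Pred; Decidable)

Minimum : Pred ℕ 0ℓ → Pred ℕ 0ℓ
Minimum P k = P k × (∀ {j} → P j → k ≤ j)

-- Abstract because least is determined by its type and unfolding it is costly.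
abstract
  least : ∀ {P} → Decidable P → ∃ P → ∃ (Minimum P)
  least {P} P? (k , p) = go k p (<-wellFounded k)
    where
    go : ∀ k → P k → Acc ℕ._<_ k → ∃ (Minimum P)
    go k p (acc rs) with ℕ.anyUpTo? P? k
    ... | yes (j , j<k , q) = go j q (rs j<k)
    ... | no  none          = k , p , λ {j} q → ℕ.≮⇒≥ λ j<k → none (j , j<k , q)

HasSize : ∀ {n} → Pred (Subset n) 0ℓ → Pred ℕ 0ℓ
HasSize P k = ∃ λ S → P S × ∣ S ∣ ≡ k

smallest : ∀ {n} {P : Pred (Subset n) 0ℓ} → Decidable P → ∃ P → ∃ (Minimum (HasSize P))
smallest P? (S , p) =
  least (λ k → anySubset? λ S → P? S ×-dec (∣ S ∣ ℕ.≟ k)) (∣ S ∣ , S , p , refl)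

minSize : ∀ {n} {P : Pred (Subset n) 0ℓ} → Decidable P → ∃ P → ℕ
minSize P? ∃P = proj₁ (smallest P? ∃P)

⟦_⟧ : ∀ {n} {P : Pred (Fin n) 0ℓ} → Decidable P → Subset n
⟦ P? ⟧ = Vec.tabulate (does ∘ P?)

∈⟦⟧⇒ : ∀ {n} {P : Pred (Fin n) 0ℓ} (P? : Decidable P) {x} → x ∈ ⟦ P? ⟧ → P x
∈⟦⟧⇒ P? {x} x∈ with P? x | trans (sym (lookup∘tabulate (does ∘ P?) x)) ([]=⇒lookup x∈)
... | yes p | _ = p

⇒∈⟦⟧ : ∀ {n} {P : Pred (Fin n) 0ℓ} (P? : Decidable P) {x} → P x → x ∈ ⟦ P? ⟧
⇒∈⟦⟧ P? {x} p =
  lookup⇒[]= x ⟦ P? ⟧ (trans (lookup∘tabulate (does ∘ P?) x) (dec-true (P? x) p))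

record Graph : Set₁ where
  field
    order      : ℕ
    {{order≢0}} : NonZero order
  V : Set
  V = Fin order
  field
    Adj        : Rel V 0ℓ
    Adj?       : Decidable₂ Adj
    Adj-sym    : Symmetric Adj
    Adj-irrefl : Irreflexive _≡_ Adj

open Graph public using (order; V; Adj; Adj?; Adj-sym; Adj-irrefl)

data Walk (G : Graph) : V G → V G → ℕ → Set where
  []  : ∀ {x} → Walk G x x 0
  _∷_ : ∀ {x y z k} → Adj G x y → Walk G y z k → Walk G x z (suc k)

Connected : Graph → Set
Connected G = ∀ x y → ∃ (Walk G x y)

Edgeless : Graph → Set
Edgeless G = ∀ x y → ¬ Adj G x y

edgeless? : Decidable Edgeless
edgeless? G = all? λ x → all? λ y → ¬? (Adj? G x y)

module _ (G : Graph) where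

  walk? : ∀ x y → Decidable (Walk G x y)
  walk? x y zero = map′ (λ { refl → [] }) (λ { [] → refl }) (x ≟ y)
  walk? x y (suc k) =
    map′ (λ { (z , e , w) → e ∷ w }) (λ { (e ∷ w) → _ , e , w })
      (any? λ z → Adj? G x z ×-dec walk? z y k)

  private
    at : ∀ {x y k} → Walk G x y k → Fin (suc k) → V G
    at {x} w       zero    = x
    at     (e ∷ w) (suc i) = at w i

    prefix : ∀ {x y k} (w : Walk G x y k) i → Walk G x (at w i) (toℕ i)
    prefix w       zero    = []
    prefix (e ∷ w) (suc i) = e ∷ prefix w i

    suffix : ∀ {x y k} (w : Walk G x y k) i →
             ∃ λ l → Walk G (at w i) y l × toℕ i + l ≡ k
    suffix w       zero    = _ , w , refl
    suffix (e ∷ w) (suc i) with suffix w i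
    ... | l , w′ , eq = l , w′ , cong suc eq

    _++_ : ∀ {x y z k l} → Walk G x y k → Walk G y z l → Walk G x z (k + l)
    []      ++ w′ = w′
    (e ∷ w) ++ w′ = e ∷ (w ++ w′)

    shorten : ∀ {x y k} → Walk G x y k → order G ≤ k → ∃ λ j → j ℕ.< k × Walk G x y j
    shorten {y = y} {k} w n≤k with pigeonhole (s≤s n≤k) (at w)
    ... | i , j , i<j , eq with suffix w j
    ... | l , w′ , j+l≡k =
      toℕ i + l ,
      subst (toℕ i + l ℕ.<_) j+l≡k (ℕ.+-monoˡ-< l i<j) ,
      prefix w i ++ subst (λ v → Walk G v y l) (sym eq) w′

    short : ∀ {x y} → ∃ (Walk G x y) → ∃ λ k → k ℕ.< order G × Walk G x y k
    short {x} {y} r with least (walk? x y) r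
    ... | k , w , min with k ℕ.<? order G
    ... | yes k<n = k , k<n , w
    ... | no  k≮n with shorten w (ℕ.≮⇒≥ k≮n)
    ... | j , j<k , w′ = contradiction (min w′) (ℕ.<⇒≱ j<k)

  reachable? : ∀ x y → Dec (∃ (Walk G x y))
  reachable? x y =
    map′ (λ { (k , _ , w) → k , w }) short (ℕ.anyUpTo? (walk? x y) (order G))

Distance : Graph → Set
Distance G = V G → V G → ℕ ⁺

-- A walk of minimum length is a path, so this is the shortest-path distance;
-- ⊤⁺ is +∞.
dist : ∀ G → Distance G
dist G x y with reachable? G x y
... | yes r = [ proj₁ (least (walk? G x y) r) ]
... | no  _ = ⊤⁺

min2 : ℕ ⁺ → ℕ ⁺
min2 [ k ] = [ k ⊓ 2 ]
min2 ⊤⁺    = [ 2 ]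

dist₂ : ∀ G → Distance G
dist₂ G x y = min2 (dist G x y)

dist-minimum : ∀ G {x y k} → Minimum (Walk G x y) k → dist G x y ≡ [ k ]
dist-minimum G {x} {y} {k} (w , min) with reachable? G x y
... | no ¬r = contradiction (k , w) ¬r
... | yes r with least (walk? G x y) r
... | j , w′ , min′ = cong [_] (ℕ.≤-antisym (min′ w) (min w′))

dist-refl : ∀ G x → dist G x x ≡ [ 0 ]
dist-refl G x = dist-minimum G ([] , λ _ → z≤n)

dist-adj : ∀ G {x y} → Adj G x y → dist G x y ≡ [ 1 ]
dist-adj G e = dist-minimum G
  (e ∷ [] , λ { [] → contradiction e (Adj-irrefl G refl) ; (_ ∷ _) → s≤s z≤n })

-- Ensures that the families of sets whose sizes are minimised below are nonempty.
Separating : ∀ G → Distance G → Set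
Separating G d = ∀ {x y} → Adj G x y → d x x ≢ d x y

dist-separating : ∀ G → Separating G (dist G)
dist-separating G {x} e eq
  with () ← trans (sym (dist-refl G x)) (trans eq (dist-adj G e))

dist₂-separating : ∀ G → Separating G (dist₂ G)
dist₂-separating G {x} {y} e eq
  with () ← trans (sym (cong min2 (dist-refl G x))) (trans eq (cong min2 (dist-adj G e)))

module _ (G : Graph) (d : Distance G) where

  Distinguishes : V G → V G → V G → Set
  Distinguishes s x y = d s x ≢ d s y

  Resolves : Rel (V G) 0ℓ → Subset (order G) → Set
  Resolves Q S = ∀ x y → Q x y → ∃ λ s → s ∈ S × Distinguishes s x y

  resolves? : ∀ {Q} → Decidable₂ Q → Decidable (Resolves Q)
  resolves? Q? S = all? λ x → all? λ y → Q? x y →-dec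
    any? λ s → (s ∈? S) ×-dec ¬? (≡-dec ℕ._≟_ (d s x) (d s y))

LocalGenerator : ∀ G → Pred (Subset (order G)) 0ℓ
LocalGenerator G = Resolves G (dist G) (Adj G)

LocalAdjGenerator : ∀ G → Pred (Subset (order G)) 0ℓ
LocalAdjGenerator G = Resolves G (dist₂ G) (Adj G)

dimₗ : Graph → ℕ
dimₗ G = minSize {P = LocalGenerator G} (resolves? G (dist G) (Adj? G))
  (⊤ , λ x y e → x , ∈⊤ , dist-separating G e)

adimₗ : Graph → ℕ
adimₗ G = minSize {P = LocalAdjGenerator G} (resolves? G (dist₂ G) (Adj? G))
  (⊤ , λ x y e → x , ∈⊤ , dist₂-separating G e)

LocalAdjBasis : ∀ G → Pred (Subset (order G)) 0ℓ
LocalAdjBasis G B = LocalAdjGenerator G B × ∣ B ∣ ≡ adimₗ G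

InOpenNbhd : ∀ G → Subset (order G) → V G → Set
InOpenNbhd G B v = ∀ b → b ∈ B → Adj G v b

Class𝒢 : Graph → Set
Class𝒢 H = ∀ B → LocalAdjBasis H B → ∃ (InOpenNbhd H B)

class𝒢? : Decidable Class𝒢
class𝒢? H = map′
  (λ none B basis → decidable-stable (nbhd? B) λ ¬nb → none (B , basis , ¬nb))
  (λ { all (B , basis , ¬nb) → ¬nb (all B basis) })
  (¬? (anySubset? λ B → basis? B ×-dec ¬? (nbhd? B)))
  where
  basis? : Decidable (LocalAdjBasis H)
  basis? B = resolves? H (dist₂ H) (Adj? H) B ×-dec (∣ B ∣ ℕ.≟ adimₗ H)
  nbhd? : ∀ B → Dec (∃ (InOpenNbhd H B))
  nbhd? B = any? λ v → all? λ b → (b ∈? B) →-dec Adj? H v b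

module _ (G : Graph) where

  ClosedNbhd : V G → Pred (V G) 0ℓ
  ClosedNbhd x z = x ≡ z ⊎ Adj G x z

  TrueTwins : Rel (V G) 0ℓ
  TrueTwins x y = ∀ z → ClosedNbhd x z ⇔ ClosedNbhd y z

  -- The union of the non-singleton true twin classes.
  T : Pred (V G) 0ℓ
  T x = ∃ λ y → x ≢ y × TrueTwins x y

  closedNbhd? : ∀ x → Decidable (ClosedNbhd x)
  closedNbhd? x z = (x ≟ z) ⊎-dec Adj? G x z

  trueTwins? : Decidable₂ TrueTwins
  trueTwins? x y = all? λ z → map′ (λ (f , g) → mk⇔ f g)
    (λ e → Equivalence.to e , Equivalence.from e)
    ((closedNbhd? x z →-dec closedNbhd? y z) ×-dec (closedNbhd? y z →-dec closedNbhd? x z))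

  T? : Decidable T
  T? x = any? λ y → ¬? (x ≟ y) ×-dec trueTwins? x y

module _ where
  private
    to : ∀ {n} (f : Fin n → ℕ) → Fin (sum (tabulate f)) → Σ (Fin n) (Fin ∘ f)
    to {suc n} f k with splitAt (f zero) k
    ... | inj₁ v = zero , v
    ... | inj₂ k′ with to (f ∘ suc) k′
    ... | i , v = suc i , v

    from : ∀ {n} (f : Fin n → ℕ) → Σ (Fin n) (Fin ∘ f) → Fin (sum (tabulate f))
    from f (zero  , v) = v ↑ˡ _
    from f (suc i , v) = f zero ↑ʳ from (f ∘ suc) (i , v)

    to∘from : ∀ {n} (f : Fin n → ℕ) p → to f (from f p) ≡ p
    to∘from f (zero  , v)
      rewrite splitAt-↑ˡ (f zero) v (sum (tabulate (f ∘ suc))) = refl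
    to∘from f (suc i , v)
      rewrite splitAt-↑ʳ (f zero) _ (from (f ∘ suc) (i , v))
            | to∘from (f ∘ suc) (i , v) = refl

    from∘to : ∀ {n} (f : Fin n → ℕ) k → from f (to f k) ≡ k
    from∘to {suc n} f k with splitAt (f zero) k | join-splitAt (f zero) (sum (tabulate (f ∘ suc))) k
    ... | inj₁ v  | eq = eq
    ... | inj₂ k′ | eq = trans (cong (f zero ↑ʳ_) (from∘to (f ∘ suc) k′)) eq

  sum↔Σ : ∀ {n} (f : Fin n → ℕ) → Fin (sum (tabulate f)) ↔ Σ (Fin n) (Fin ∘ f)
  sum↔Σ f = mk↔ₛ′ (to f) (from f) (to∘from f) (from∘to f)

module _ (G : Graph) (H : V G → Graph) where

  data LexAdj : Rel (Σ (V G) (V ∘ H)) 0ℓ where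
    across : ∀ {i j v w} → Adj G i j → LexAdj (i , v) (j , w)
    within : ∀ {i v w} → Adj (H i) v w → LexAdj (i , v) (i , w)

  lexAdj? : Decidable₂ LexAdj
  lexAdj? (i , v) (j , w) with Adj? G i j | i ≟ j
  ... | yes e | _        = yes (across e)
  ... | no ¬e | no i≢j   = no λ { (across e) → ¬e e ; (within _) → i≢j refl }
  ... | no ¬e | yes refl =
    map′ within (λ { (across e) → contradiction e ¬e ; (within e) → e }) (Adj? (H i) v w)

  private
    lex-sym : Symmetric LexAdj
    lex-sym (across e) = across (Adj-sym G e)
    lex-sym (within e) = within (Adj-sym (H _) e)

    lex-irrefl : Irreflexive _≡_ LexAdj
    lex-irrefl refl (across e) = Adj-irrefl G refl e
    lex-irrefl refl (within e) = Adj-irrefl (H _) refl e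

    vertex : (K : Graph) → V K
    vertex record { order = suc _ } = zero

  -- The vertices are those of ⋃ᵢ {uᵢ} × V(Hᵢ), enumerated along sum↔Σ.
  lexProduct : Graph
  lexProduct = record
    { order      = sum (tabulate (order ∘ H))
    ; order≢0    = nonZeroIndex
                     (Inverse.from (sum↔Σ (order ∘ H)) (vertex G , vertex (H (vertex G))))
    ; Adj        = LexAdj on pair
    ; Adj?       = λ x y → lexAdj? (pair x) (pair y)
    ; Adj-sym    = lex-sym
    ; Adj-irrefl = λ eq → lex-irrefl (cong pair eq)
    }
    where
    pair : Fin (sum (tabulate (order ∘ H))) → Σ (V G) (V ∘ H)
    pair = Inverse.to (sum↔Σ (order ∘ H))

module _ (G : Graph) (H : V G → Graph) where

  V-E : Pred (V G) 0ℓ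
  V-E x = ¬ T G x × Edgeless (H x)

  I : Pred (V G) 0ℓ
  I x = Class𝒢 (H x)

  -- A choice of one vertex of I ∩ Uⱼ for each j with I ∩ Uⱼ ≠ ∅, as a function of the
  -- members of I ∩ Uⱼ that depends on j only; its values elsewhere are irrelevant.
  record TwinChoice : Set where
    field
      chosen       : V G → V G
      chosen-I     : ∀ {x} → I x → T G x → I (chosen x)
      chosen-twin  : ∀ {x} → I x → T G x → TrueTwins G x (chosen x)
      chosen-class : ∀ {x y} → I x → T G x → I y → T G y →
                     TrueTwins G x y → chosen x ≡ chosen y

  module _ (c : TwinChoice) where
    open TwinChoice c

    -- ⋃ⱼ I′ⱼ
    I′ : Pred (V G) 0ℓ
    I′ x = I x × T G x × x ≢ chosen x

    X-E : Pred (V G) 0ℓ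
    X-E x = I x × ¬ I′ x

    X-E? : Decidable X-E
    X-E? x = class𝒢? (H x) ×-dec
             ¬? (class𝒢? (H x) ×-dec T? G x ×-dec ¬? (x ≟ chosen x))

    module _ (d : Distance G) where

      -- ℛ for d = dist G, ℛ′ for d = dist₂ G.
      ℛ : Rel (V G) 0ℓ
      ℛ x y = X-E x × X-E y × Adj G x y ×
              (∀ u → ¬ V-E u → u ≢ x → u ≢ y → d u x ≡ d u y)

      ℛ? : Decidable₂ ℛ
      ℛ? x y = X-E? x ×-dec X-E? y ×-dec Adj? G x y ×-dec
        all? λ u → ¬? (¬? (T? G u) ×-dec edgeless? (H u)) →-dec
          (¬? (u ≟ x) →-dec (¬? (u ≟ y) →-dec ≡-dec ℕ._≟_ (d u x) (d u y)))

      ℛ-Generator : Pred (Subset (order G)) 0ℓ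
      ℛ-Generator A = (∀ a → a ∈ A → X-E a) × Resolves G d ℛ A

      ℛ-generator? : Decidable ℛ-Generator
      ℛ-generator? A =
        (all? λ a → (a ∈? A) →-dec X-E? a) ×-dec resolves? G d ℛ? A

      ∃-ℛ-generator : Separating G d → ∃ ℛ-Generator
      ∃-ℛ-generator sep = A , sound , λ x y (x∈X , _ , e , _) → x , complete x x∈X , sep e
        where
        A : Subset (order G)
        A = ⟦ X-E? ⟧
        sound : ∀ a → a ∈ A → X-E a
        sound a = ∈⟦⟧⇒ X-E?
        complete : ∀ x → X-E x → x ∈ A
        complete x = ⇒∈⟦⟧ X-E?

    ϱ : ℕ
    ϱ = minSize {P = ℛ-Generator (dist G)} (ℛ-generator? (dist G))
      (∃-ℛ-generator (dist G) (dist-separating G))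

    ϱ′ : ℕ
    ϱ′ = minSize {P = ℛ-Generator (dist₂ G)} (ℛ-generator? (dist₂ G))
      (∃-ℛ-generator (dist₂ G) (dist₂-separating G))

{-# OPTIONS --safe #-}
module Submission where

-- For each of the two metrics, the minimum size of a generator of G ∘ ℋ is
-- ∑ᵢ adimₗ(Hᵢ) + |⋃ⱼ I′ⱼ| plus the corresponding number ϱ or ϱ′, so the first two terms
-- cancel in the comparison.  Two adjacent vertices in one copy Hᵢ can only be distinguished
-- inside that copy, and there exactly as by d_{Hᵢ,2}: a generator consists of local adjacency
-- generators Sᵢ of the Hᵢ.  All pairs between adjacent copies i, j are distinguished iff Sᵢ or
-- Sⱼ lies in no open neighbourhood, or some nonempty Sₖ with k ≠ i, j sees i and j at
-- different distances.  Lying in no open neighbourhood costs one vertex more than adimₗ(Hᵢ)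
-- exactly when Hᵢ ∈ 𝒢, and this price has to be paid by all but at most one member of
-- each true twin class of such i; which one is spared does not matter, so it can be the
-- chosen one, and the remaining conditions on X_E are those defining ϱ and ϱ′.

open import Defs
open import Data.Bool.Base using (Bool; true; false)
open import Data.Fin.Base using (Fin; zero; suc; _↑ˡ_; _↑ʳ_)
open import Data.Fin.Properties using (_≟_; any?; all?; ¬∀⟶∃¬; suc-injective; 0≢1+n)
open import Data.Fin.Subset
  using (Subset; inside; outside; ⊥; ⊤; _∈_; _∉_; ∣_∣; _-_; Nonempty)
open import Data.Fin.Subset.Properties
  using (_∈?_; ∈⊤; ∣⊥∣≡0; nonempty?; anySubset?;
         x∈p∧x≢y⇒x∈p-y; x∈p⇒∣p-x∣<∣p∣; p⊆q⇒∣p∣≤∣q∣)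
open import Data.List.Base using (tabulate)
open import Data.Nat.Base as ℕ using (ℕ; zero; suc; _+_; _≤_; z≤n; s≤s)
import Data.Nat.Properties as ℕ
import Data.Nat.ListAction as List
open import Data.Product.Base using (Σ; ∃; _×_; _,_; proj₁; proj₂)
open import Data.Sum.Base using (_⊎_; inj₁; inj₂; [_,_]′)
import Data.Vec.Base as Vec
open import Data.Vec.Base using (_∷_; here; there; _[_]≔_)
open import Data.Vec.Properties
  using (lookup⇒[]=; []=⇒lookup; lookup∘tabulate; tabulate∘lookup; tabulate-cong;
         []≔-updates; []≔-minimal)
open import Function.Base using (_∘_; id)
open import Function.Bundles using (_⇔_; mk⇔; Equivalence; Inverse)
open import Level using (0ℓ)
open import Relation.Binary.PropositionalEquality
  using (_≡_; _≢_; refl; sym; trans; cong; subst; subst₂; ≢-sym; module ≡-Reasoning)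
open import Relation.Nullary.Construct.Add.Supremum using (⊤⁺; [_]; ≡-dec)
open import Relation.Nullary.Decidable
  using (Dec; yes; no; does; ¬?; _×-dec_; _⊎-dec_; _→-dec_; decidable-stable)
open import Relation.Nullary.Negation using (¬_; contradiction)
open import Relation.Unary using (Pred; Decidable)
open import Algebra.Properties.CommutativeMonoid.Sum ℕ.+-0-commutativeMonoid
  using (∑-distrib-+; sum-cong-≗) renaming (sum to ∑)

-- Sums and sizes of subsets.

∑-mono-≤ : ∀ {n} {f g : Fin n → ℕ} → (∀ i → f i ≤ g i) → ∑ f ≤ ∑ g
∑-mono-≤ {zero}  f≤g = z≤n
∑-mono-≤ {suc n} f≤g = ℕ.+-mono-≤ (f≤g zero) (∑-mono-≤ (f≤g ∘ suc))

indicator : Bool → ℕ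
indicator false = 0
indicator true  = 1

∣b∷p∣ : ∀ {n} b (p : Subset n) → ∣ b ∷ p ∣ ≡ indicator b + ∣ p ∣
∣b∷p∣ false p = refl
∣b∷p∣ true  p = refl

∣tabulate∣≡∑ : ∀ {n} (g : Fin n → Bool) → ∣ Vec.tabulate g ∣ ≡ ∑ (indicator ∘ g)
∣tabulate∣≡∑ {zero}  g = refl
∣tabulate∣≡∑ {suc n} g =
  trans (∣b∷p∣ (g zero) (Vec.tabulate (g ∘ suc)))
    (cong (indicator (g zero) +_) (∣tabulate∣≡∑ (g ∘ suc)))

∣tabulate∣-+ : ∀ m {n} (g : Fin (m + n) → Bool) →
  ∣ Vec.tabulate g ∣ ≡ ∣ Vec.tabulate (g ∘ (_↑ˡ n)) ∣ + ∣ Vec.tabulate (g ∘ (m ↑ʳ_)) ∣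
∣tabulate∣-+ zero    g = refl
∣tabulate∣-+ (suc m) {n} g
  rewrite ∣b∷p∣ (g zero) (Vec.tabulate (g ∘ suc))
        | ∣b∷p∣ (g zero) (Vec.tabulate (g ∘ suc ∘ (_↑ˡ n)))
        | ∣tabulate∣-+ m (g ∘ suc) =
  sym (ℕ.+-assoc (indicator (g zero)) _ _)

-- `Inverse.from (sum↔Σ f)` puts the first fibre in the left block and the others in the right one,
-- so induction on `n` splits off one fibre at a time.
∣tabulate∣-sum : ∀ {n} (f : Fin n → ℕ) (g : Fin (List.sum (tabulate f)) → Bool) →
  ∣ Vec.tabulate g ∣ ≡
  ∑ (λ i → ∣ Vec.tabulate (λ v → g (Inverse.from (sum↔Σ f) (i , v))) ∣)
∣tabulate∣-sum {zero}  f g = refl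
∣tabulate∣-sum {suc n} f g =
  trans (∣tabulate∣-+ (f zero) g)
    (cong (∣ Vec.tabulate (g ∘ (_↑ˡ List.sum (tabulate (f ∘ suc)))) ∣ +_)
      (∣tabulate∣-sum (f ∘ suc) (g ∘ (f zero ↑ʳ_))))

∣⟦⊎⟧∣ : ∀ {n} {P Q : Pred (Fin n) 0ℓ} (P? : Decidable P) (Q? : Decidable Q) →
  (∀ x → P x → ¬ Q x) →
  ∣ ⟦ (λ x → P? x ⊎-dec Q? x) ⟧ ∣ ≡ ∣ ⟦ P? ⟧ ∣ + ∣ ⟦ Q? ⟧ ∣
∣⟦⊎⟧∣ {zero}  P? Q? disjoint = refl
∣⟦⊎⟧∣ {suc n} P? Q? disjoint with P? zero | Q? zero | ∣⟦⊎⟧∣ (P? ∘ suc) (Q? ∘ suc) (disjoint ∘ suc)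
... | yes p | yes q | _  = contradiction q (disjoint zero p)
... | yes _ | no _  | eq = cong suc eq
... | no _  | yes _ | eq = trans (cong suc eq) (sym (ℕ.+-suc _ _))
... | no _  | no _  | eq = eq

-- `R` may relate an element to several others. The image of each member of `S` is removed from `T`
-- before the recursive call, and left-uniqueness keeps the later images off it.
∣∣-injection : ∀ {m n} (S : Subset m) (T : Subset n) (R : Fin m → Fin n → Set) →
  (∀ x → x ∈ S → ∃ λ y → y ∈ T × R x y) →
  (∀ {x x′ y} → R x y → R x′ y → x ≡ x′) →
  ∣ S ∣ ≤ ∣ T ∣
∣∣-injection Vec.[]        T R image inj = z≤n
∣∣-injection (outside ∷ S) T R image inj =
  ∣∣-injection S T (R ∘ suc) (λ x → image (suc x) ∘ there) λ r r′ → suc-injective (inj r r′)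
∣∣-injection (inside ∷ S) T R image inj with image zero here
... | y₀ , y₀∈T , r₀ = ℕ.≤-trans
  (s≤s (∣∣-injection S (T - y₀) (R ∘ suc) image′ λ r r′ → suc-injective (inj r r′)))
  (x∈p⇒∣p-x∣<∣p∣ y₀∈T)
  where
  image′ : ∀ x → x ∈ S → ∃ λ y → y ∈ T - y₀ × R (suc x) y
  image′ x x∈S with image (suc x) (there x∈S)
  ... | y , y∈T , r = y , x∈p∧x≢y⇒x∈p-y y∈T (λ { refl → 0≢1+n (sym (inj r r₀)) }) , r

∣p[x]≔inside∣ : ∀ {n} (p : Subset n) x → ∣ p [ x ]≔ inside ∣ ≤ ∣ p ∣ + 1
∣p[x]≔inside∣ (outside ∷ p) zero    = ℕ.≤-reflexive (ℕ.+-comm 1 ∣ p ∣)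
∣p[x]≔inside∣ (inside ∷ p)  zero    = ℕ.m≤m+n _ 1
∣p[x]≔inside∣ (outside ∷ p) (suc x) = ∣p[x]≔inside∣ p x
∣p[x]≔inside∣ (inside ∷ p)  (suc x) = s≤s (∣p[x]≔inside∣ p x)

∈-[]≔inside : ∀ {n} {p : Subset n} x {y} → y ∈ p → y ∈ p [ x ]≔ inside
∈-[]≔inside {p = p} x {y} y∈p with y ≟ x
... | yes refl = []≔-updates p y
... | no y≢x   = []≔-minimal p y x y≢x y∈p

-- Comparing minimum sizes.

minSize-minimum : ∀ {n} {P : Pred (Subset n) 0ℓ} (P? : Decidable P) (∃P : ∃ P) →
  Minimum (HasSize P) (minSize P? ∃P)
minSize-minimum P? ∃P = proj₂ (smallest P? ∃P)

-- Each minimiser is converted into a candidate for the other minimum, and the two resulting bounds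
-- meet.
Minimum-shift : ∀ {m n} {P : Pred (Subset m) 0ℓ} {Q : Pred (Subset n) 0ℓ} {k r} c →
  Minimum (HasSize P) k → Minimum (HasSize Q) r →
  (∀ {S} → P S → ∃ λ A → Q A × c + ∣ A ∣ ≤ ∣ S ∣) →
  (∀ {A} → Q A → ∃ λ S → P S × ∣ S ∣ ≤ c + ∣ A ∣) →
  k ≡ c + r
Minimum-shift c ((S , p , refl) , minP) ((A , q , refl) , minQ) lower upper
  with lower p | upper q
... | A′ , q′ , c+A′≤S | S′ , p′ , S′≤c+A = ℕ.≤-antisym
  (ℕ.≤-trans (minP (S′ , p′ , refl)) S′≤c+A)
  (ℕ.≤-trans (ℕ.+-monoʳ-≤ c (minQ (A′ , q′ , refl))) c+A′≤S)

-- Walks and distances.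

vertex : (K : Graph) → V K
vertex record { order = suc _ } = zero

-- Transfers may shorten a walk, because projections and moves to a twin drop steps; transfers in
-- both directions still force equal minimum lengths.
dist-cong : ∀ {G K x y x′ y′} →
  (∀ {n} → Walk G x y n → ∃ λ m → m ≤ n × Walk K x′ y′ m) →
  (∀ {n} → Walk K x′ y′ n → ∃ λ m → m ≤ n × Walk G x y m) →
  ∃ (Walk K x′ y′) → dist G x y ≡ dist K x′ y′
dist-cong {G} {K} {x} {y} {x′} {y′} to from r with least (walk? K x′ y′) r
... | k , w , min with from w
... | j , j≤k , w′ =
  trans (dist-minimum G (subst (Walk G x y) (ℕ.≤-antisym j≤k (bound w′)) w′ , bound))
        (sym (dist-minimum K (w , min)))
  where
  bound : ∀ {n} → Walk G x y n → k ≤ n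
  bound w with to w
  ... | m , m≤n , w′ = ℕ.≤-trans (min w′) m≤n

_∷ʳ_ : ∀ {G x y z n} → Walk G x y n → Adj G y z → Walk G x z (suc n)
[]      ∷ʳ e = e ∷ []
(f ∷ w) ∷ʳ e = f ∷ (w ∷ʳ e)

reverse : ∀ {G x y n} → Walk G x y n → Walk G y x n
reverse []          = []
reverse {G} (e ∷ w) = reverse w ∷ʳ Adj-sym G e

dist-sym : ∀ G → Connected G → ∀ x y → dist G x y ≡ dist G y x
dist-sym G conn x y = dist-cong {G} {G}
  (λ w → _ , ℕ.≤-refl , reverse w) (λ w → _ , ℕ.≤-refl , reverse w) (conn y x)

-- True twins and their distances.

module Twins (G : Graph) where

  twins-refl : ∀ {x} → TrueTwins G x x
  twins-refl z = mk⇔ id id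

  twins-sym : ∀ {x y} → TrueTwins G x y → TrueTwins G y x
  twins-sym t z = mk⇔ (Equivalence.from (t z)) (Equivalence.to (t z))

  twins-trans : ∀ {x y z} → TrueTwins G x y → TrueTwins G y z → TrueTwins G x z
  twins-trans t t′ z = mk⇔ (Equivalence.to (t′ z) ∘ Equivalence.to (t z))
                           (Equivalence.from (t z) ∘ Equivalence.from (t′ z))

  twins-closed : ∀ {x y z} → TrueTwins G x y → ClosedNbhd G x z → ClosedNbhd G y z
  twins-closed {z = z} t = Equivalence.to (t z)

  closed-sym : ∀ {x y} → ClosedNbhd G x y → ClosedNbhd G y x
  closed-sym (inj₁ eq) = inj₁ (sym eq)
  closed-sym (inj₂ e)  = inj₂ (Adj-sym G e)

  closed-adj : ∀ {x y} → x ≢ y → ClosedNbhd G x y → Adj G x y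
  closed-adj x≢y (inj₁ eq) = contradiction eq x≢y
  closed-adj x≢y (inj₂ e)  = e

  twins-adj : ∀ {x y} → x ≢ y → TrueTwins G x y → Adj G x y
  twins-adj x≢y t = closed-adj x≢y (twins-closed (twins-sym t) (inj₁ refl))

  -- The first step out of `x` ends in the closed neighbourhood of `y`: either at `y`, where the
  -- step is dropped, or at a neighbour of `y`.
  twin-walk : ∀ {x y k n} → TrueTwins G x y → k ≢ x →
              Walk G x k n → ∃ λ m → m ≤ n × Walk G y k m
  twin-walk t k≢x [] = contradiction refl k≢x
  twin-walk {y = y} t k≢x (_∷_ {y = z} e w) with twins-closed t (inj₂ e)
  ... | inj₁ refl = _ , ℕ.n≤1+n _ , w
  ... | inj₂ e′   = _ , ℕ.≤-refl , e′ ∷ w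

  dist-twinsˡ : Connected G → ∀ {x y k} → TrueTwins G x y → k ≢ x → k ≢ y →
                dist G x k ≡ dist G y k
  dist-twinsˡ conn t k≢x k≢y = dist-cong {G} {G}
    (twin-walk t k≢x) (twin-walk (twins-sym t) k≢y) (conn _ _)

-- The truncated distance in terms of equality and adjacency.

dist₂-adj : ∀ K {x y} → Adj K x y → dist₂ K x y ≡ [ 1 ]
dist₂-adj K e = cong min2 (dist-adj K e)

dist₂-far : ∀ K {x y} → x ≢ y → ¬ Adj K x y → dist₂ K x y ≡ [ 2 ]
dist₂-far K {x} {y} x≢y ¬e with reachable? K x y
... | no _  = refl
... | yes r with least (walk? K x y) r
... | zero        , [] , _     = contradiction refl x≢y
... | suc zero    , e ∷ [] , _ = contradiction e ¬e
... | suc (suc k) , _          = cong (λ m → [ suc (suc m) ]) (ℕ.⊓-zeroʳ k)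

dist₂≡1⇒adj : ∀ K {x y} → dist₂ K x y ≡ [ 1 ] → Adj K x y
dist₂≡1⇒adj K {x} {y} eq with x ≟ y | Adj? K x y
... | _        | yes e = e
... | yes refl | no _  with () ← trans (sym (cong min2 (dist-refl K x))) eq
dist₂≡1⇒adj K {x} {y} eq | no x≢y | no ¬e with () ← trans (sym (dist₂-far K x≢y ¬e)) eq

-- Local adjacency generators of one graph.

module _ (K : Graph) where

  -- The positive form of lying in no open neighbourhood: for each `v` it supplies the element that
  -- later tells `v` from the vertices of an adjacent copy.
  Undominated : Pred (Subset (order K)) 0ℓ
  Undominated B = ∀ v → ∃ λ b → b ∈ B × ¬ Adj K v b

  undominated? : Decidable Undominated
  undominated? B = all? λ v → any? λ b → (b ∈? B) ×-dec ¬? (Adj? K v b)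

  dominated : ∀ {B} → ¬ Undominated B → ∃ (InOpenNbhd K B)
  dominated {B} ¬u
    with ¬∀⟶∃¬ _ _ (λ v → any? λ b → (b ∈? B) ×-dec ¬? (Adj? K v b)) ¬u
  ... | v , none = v , λ b b∈B → decidable-stable (Adj? K v b) λ ¬e → none (b , b∈B , ¬e)

  undominated⇒nonempty : ∀ {B} → Undominated B → Nonempty B
  undominated⇒nonempty u with u (vertex K)
  ... | b , b∈B , _ = b , b∈B

  edgeless⇒undominated : Edgeless K → ∀ {B} → Nonempty B → Undominated B
  edgeless⇒undominated none (b , b∈B) v = b , b∈B , none v b

  generator⇒nonempty : ¬ Edgeless K → ∀ {B} → LocalAdjGenerator K B → Nonempty B
  generator⇒nonempty ¬none {B} gen = decidable-stable (nonempty? B) λ empty →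
    ¬none λ x y e → let s , s∈B , _ = gen x y e in empty (s , s∈B)

  adimₗ-minimum : Minimum (HasSize (LocalAdjGenerator K)) (adimₗ K)
  adimₗ-minimum = minSize-minimum {P = LocalAdjGenerator K} (resolves? K (dist₂ K) (Adj? K))
    (⊤ , λ x y e → x , ∈⊤ , dist₂-separating K e)

  basis : ∃ (LocalAdjBasis K)
  basis = proj₁ adimₗ-minimum

  adimₗ-≤ : ∀ {B} → LocalAdjGenerator K B → adimₗ K ≤ ∣ B ∣
  adimₗ-≤ gen = proj₂ adimₗ-minimum (_ , gen , refl)

  -- Without edges the empty set is a generator, so it is the only basis, and it lies in every
  -- neighbourhood.
  edgeless⇒𝒢 : Edgeless K → Class𝒢 K
  edgeless⇒𝒢 none B (_ , size) = vertex K , λ b b∈B → contradiction b∈B (empty b)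
    where
    ∣B∣≡0 : ∣ B ∣ ≡ 0
    ∣B∣≡0 = ℕ.n≤0⇒n≡0 (ℕ.≤-trans (ℕ.≤-reflexive size)
      (ℕ.≤-trans (adimₗ-≤ {⊥} λ x y e → contradiction e (none x y)) (ℕ.≤-reflexive (∣⊥∣≡0 (order K)))))
    empty : ∀ b → b ∉ B
    empty b b∈B with () ← ℕ.<-≤-trans (x∈p⇒∣p-x∣<∣p∣ b∈B) (ℕ.≤-reflexive ∣B∣≡0)

  -- With only `adimₗ K` elements the generator would be a basis, and membership in 𝒢 would dominate
  -- it.
  𝒢-undominated-size : Class𝒢 K → ∀ {B} → LocalAdjGenerator K B → Undominated B →
                       suc (adimₗ K) ≤ ∣ B ∣
  𝒢-undominated-size k∈𝒢 {B} gen u = ℕ.≤∧≢⇒< (adimₗ-≤ gen) λ eq →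
    let v , nb = k∈𝒢 B (gen , sym eq); b , b∈B , ¬e = u v in ¬e (nb b b∈B)

  ∉𝒢-undominated : ¬ Class𝒢 K → ∃ λ B → LocalAdjBasis K B × Undominated B
  ∉𝒢-undominated k∉𝒢 = decidable-stable
    (anySubset? λ B → (resolves? K (dist₂ K) (Adj? K) B ×-dec (∣ B ∣ ℕ.≟ adimₗ K))
                      ×-dec undominated? B)
    λ none → k∉𝒢 λ B isBasis → dominated λ u → none (B , isBasis , u)

  -- A vertex dominating a basis B and v would not be distinguished from v by B.
  𝒢-undominated : Class𝒢 K →
                  ∃ λ B → LocalAdjGenerator K B × ∣ B ∣ ≤ adimₗ K + 1 × Undominated B
  𝒢-undominated k∈𝒢 with basis
  ... | B , gen , size with k∈𝒢 B (gen , size)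
  ... | v , nb = B [ v ]≔ inside , gen′ ,
    subst (λ a → ∣ B [ v ]≔ inside ∣ ≤ a + 1) size (∣p[x]≔inside∣ B v) , undom
    where
    gen′ : LocalAdjGenerator K (B [ v ]≔ inside)
    gen′ x y e with gen x y e
    ... | s , s∈B , s≠ = s , ∈-[]≔inside v s∈B , s≠
    undom : Undominated (B [ v ]≔ inside)
    undom w with Adj? K w v
    ... | no ¬e = v , []≔-updates B v , ¬e
    ... | yes e with gen w v e
    ... | s , s∈B , s≠ = s , ∈-[]≔inside v s∈B , λ e′ → s≠
      (trans (dist₂-adj K (Adj-sym K e′)) (sym (dist₂-adj K (Adj-sym K (nb s s∈B)))))

-- Vertices and distances of the lexicographic product.

module LexVertices (G : Graph) (H : V G → Graph) where

  L : Graph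
  L = lexProduct G H

  to : V L → Σ (V G) (V ∘ H)
  to = Inverse.to (sum↔Σ (order ∘ H))

  from : Σ (V G) (V ∘ H) → V L
  from = Inverse.from (sum↔Σ (order ∘ H))

  to∘from : ∀ p → to (from p) ≡ p
  to∘from = Inverse.strictlyInverseˡ (sum↔Σ (order ∘ H))

  from∘to : ∀ x → from (to x) ≡ x
  from∘to = Inverse.strictlyInverseʳ (sum↔Σ (order ∘ H))

module LexDistance (G : Graph) (conn : Connected G) (2≤n : 2 ≤ order G)
                   (H : V G → Graph) where

  open LexVertices G H

  Adj-from⁺ : ∀ {p q} → LexAdj G H p q → Adj L (from p) (from q)
  Adj-from⁺ {p} {q} = subst₂ (LexAdj G H) (sym (to∘from p)) (sym (to∘from q))

  Adj-from⁻ : ∀ {p q} → Adj L (from p) (from q) → LexAdj G H p q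
  Adj-from⁻ {p} {q} = subst₂ (LexAdj G H) (to∘from p) (to∘from q)

  within⁻¹ : ∀ {i v w} → LexAdj G H (i , v) (i , w) → Adj (H i) v w
  within⁻¹ (across e) = contradiction e (Adj-irrefl G refl)
  within⁻¹ (within e) = e

  step : ∀ {p q} → LexAdj G H p q → proj₁ p ≡ proj₁ q ⊎ Adj G (proj₁ p) (proj₁ q)
  step (across e) = inj₂ e
  step (within e) = inj₁ refl

  project : ∀ {x y n} → Walk L x y n →
            ∃ λ m → m ≤ n × Walk G (proj₁ (to x)) (proj₁ (to y)) m
  project [] = 0 , z≤n , []
  project {y = y} (e ∷ w) with project w | step e
  ... | m , m≤n , w′ | inj₁ eq =
    m , ℕ.m≤n⇒m≤1+n m≤n , subst (λ i → Walk G i (proj₁ (to y)) m) (sym eq) w′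
  ... | m , m≤n , w′ | inj₂ e′ = suc m , s≤s m≤n , e′ ∷ w′

  -- A step across reaches every vertex of the next copy, so both ends are free once there is at
  -- least one step. For `i` equal to `j` this joins two vertices of one copy.
  lift : ∀ {i j n} v w → Walk G i j (suc n) → Walk L (from (i , v)) (from (j , w)) (suc n)
  lift v w (e ∷ [])        = Adj-from⁺ (across e) ∷ []
  lift v w (e ∷ u@(_ ∷ _)) = Adj-from⁺ (across e) ∷ lift (vertex (H _)) w u

  -- The order bound gives a second vertex, and a walk to it starts with an edge. That edge is the
  -- detour through another copy in `dist-near`.
  neighbour : ∀ i → ∃ (Adj G i)
  neighbour i with other i 2≤n
    where
    other : ∀ {n} (i : Fin n) → 2 ≤ n → ∃ (i ≢_)
    other zero    (s≤s (s≤s _)) = suc zero , λ ()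
    other (suc i) (s≤s (s≤s _)) = zero , λ ()
  ... | j , i≢j with conn i j
  ... | _ , []    = contradiction refl i≢j
  ... | _ , e ∷ _ = _ , e

  dist-far : ∀ {i j v w} → i ≢ j → dist L (from (i , v)) (from (j , w)) ≡ dist G i j
  dist-far {i} {j} {v} {w} i≢j = dist-cong {L} {G} down up (conn i j)
    where
    down : ∀ {n} → Walk L (from (i , v)) (from (j , w)) n → ∃ λ m → m ≤ n × Walk G i j m
    down u with project u
    ... | m , m≤n , u′ = m , m≤n ,
      subst₂ (λ p q → Walk G (proj₁ p) (proj₁ q) m) (to∘from (i , v)) (to∘from (j , w)) u′
    up : ∀ {n} → Walk G i j n → ∃ λ m → m ≤ n × Walk L (from (i , v)) (from (j , w)) m
    up []        = contradiction refl i≢j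
    up u@(_ ∷ _) = _ , ℕ.≤-refl , lift v w u

  -- Nonadjacent vertices of a copy are joined in two steps through an adjacent copy, so the full
  -- distance is already truncated there.
  dist-near : ∀ {i v w} → dist L (from (i , v)) (from (i , w)) ≡ dist₂ (H i) v w
  dist-near {i} {v} {w} with v ≟ w
  ... | yes refl = trans (dist-refl L _) (sym (cong min2 (dist-refl (H i) v)))
  ... | no v≢w with Adj? (H i) v w
  ... | yes e = trans (dist-adj L (Adj-from⁺ (within e))) (sym (dist₂-adj (H i) e))
  ... | no ¬e = trans (dist-minimum L (walk , bound)) (sym (dist₂-far (H i) v≢w ¬e))
    where
    walk : Walk L (from (i , v)) (from (i , w)) 2
    walk with neighbour i
    ... | j , e = lift v w (e ∷ Adj-sym G e ∷ [])
    from-injective : ∀ {p q} → from p ≡ from q → p ≡ q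
    from-injective {p} {q} eq = trans (sym (to∘from p)) (trans (cong to eq) (to∘from q))
    -- The endpoint is a variable with an equation, so that the walk can be matched on.
    shorter : ∀ {x n} → x ≡ from (i , w) → Walk L (from (i , v)) x n → 2 ≤ n
    shorter eq []            with refl ← from-injective {i , v} {i , w} eq = contradiction refl v≢w
    shorter eq (e ∷ [])      with refl ← eq = contradiction (within⁻¹ (Adj-from⁻ e)) ¬e
    shorter eq (_ ∷ (_ ∷ _)) = s≤s (s≤s z≤n)
    bound : ∀ {n} → Walk L (from (i , v)) (from (i , w)) n → 2 ≤ n
    bound = shorter refl

  dist₂-near : ∀ {i v w} → dist₂ L (from (i , v)) (from (i , w)) ≡ dist₂ (H i) v w
  dist₂-near {i} {v} {w} = trans (cong min2 dist-near) (min2-idem (dist (H i) v w))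
    where
    min2-idem : ∀ k → min2 (min2 k) ≡ min2 k
    min2-idem ⊤⁺    = refl
    min2-idem [ k ] = cong [_] (ℕ.m≤n⇒m⊓n≡m (ℕ.m⊓n≤n k 2))

-- The twin choice and the summand common to both metrics.

module TwinChoices (G : Graph) (H : V G → Graph) (c : TwinChoice G H) where

  open TwinChoice c
  open Twins G

  V-E? : Decidable (V-E G H)
  V-E? u = ¬? (T? G u) ×-dec edgeless? (H u)

  -- Abstract because unfolding class𝒢? is costly.
  abstract
    I′? : Decidable (I′ G H c)
    I′? x = class𝒢? (H x) ×-dec T? G x ×-dec ¬? (x ≟ chosen x)

  offset : ℕ
  offset = ∑ (adimₗ ∘ H) + ∣ ⟦ I′? ⟧ ∣

  offset+ : ∀ {P : Pred (V G) 0ℓ} (P? : Decidable P) → (∀ x → P x → ¬ I′ G H c x) →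
    offset + ∣ ⟦ P? ⟧ ∣ ≡
    ∑ (λ i → adimₗ (H i) + indicator (does (P? i ⊎-dec I′? i)))
  offset+ P? disjoint = begin
    ∑ (adimₗ ∘ H) + ∣ ⟦ I′? ⟧ ∣ + ∣ ⟦ P? ⟧ ∣       ≡⟨ ℕ.+-assoc (∑ (adimₗ ∘ H)) _ _ ⟩
    ∑ (adimₗ ∘ H) + (∣ ⟦ I′? ⟧ ∣ + ∣ ⟦ P? ⟧ ∣)     ≡⟨ cong (∑ (adimₗ ∘ H) +_) (ℕ.+-comm ∣ ⟦ I′? ⟧ ∣ _) ⟩
    ∑ (adimₗ ∘ H) + (∣ ⟦ P? ⟧ ∣ + ∣ ⟦ I′? ⟧ ∣)     ≡⟨ cong (∑ (adimₗ ∘ H) +_) (∣⟦⊎⟧∣ P? I′? disjoint) ⟨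
    ∑ (adimₗ ∘ H) + ∣ ⟦ (λ x → P? x ⊎-dec I′? x) ⟧ ∣
      ≡⟨ cong (∑ (adimₗ ∘ H) +_) (∣tabulate∣≡∑ (λ i → does (P? i ⊎-dec I′? i))) ⟩
    ∑ (adimₗ ∘ H) + ∑ (λ i → indicator (does (P? i ⊎-dec I′? i)))
      ≡⟨ ∑-distrib-+ (adimₗ ∘ H) _ ⟨
    ∑ (λ i → adimₗ (H i) + indicator (does (P? i ⊎-dec I′? i))) ∎
    where open ≡-Reasoning

  unchosen : ∀ {x y} → I G H x → TrueTwins G x y → x ≢ y → I G H y → y ≡ chosen y → I′ G H c x
  unchosen {x} {y} x∈I t x≢y y∈I y≡ = x∈I , (y , x≢y , t) , λ x≡ →
    x≢y (trans x≡ (trans (chosen-class x∈I (y , x≢y , t) y∈I (x , ≢-sym x≢y , twins-sym t) t) (sym y≡)))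

  X-E-chosen : ∀ {x} → X-E G H c x → T G x → x ≡ chosen x
  X-E-chosen {x} (x∈I , x∉I′) x∈T = decidable-stable (x ≟ chosen x) λ x≢ → x∉I′ (x∈I , x∈T , x≢)

  -- Two distinct twins in `X-E` would both be the chosen vertex of their class.
  X-E-twins : ∀ {x y} → X-E G H c x → X-E G H c y → TrueTwins G x y → x ≡ y
  X-E-twins {x} {y} x∈X@(x∈I , x∉I′) y∈X@(y∈I , _) t = decidable-stable (x ≟ y) λ x≢y →
    x∉I′ (unchosen x∈I t x≢y y∈I (X-E-chosen y∈X (x , ≢-sym x≢y , twins-sym t)))

-- Generators of the product, copy by copy, for either metric.

module LexGenerators
  (G : Graph) (H : V G → Graph) (c : TwinChoice G H)
  (d : Distance G) (dₗ : Distance (lexProduct G H))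
  (d-self : ∀ {x} → d x x ≡ [ 0 ])
  (d-adj : ∀ {x y} → Adj G x y → d x y ≡ [ 1 ])
  (d-twins : ∀ {x y k} → TrueTwins G x y → k ≢ x → k ≢ y → d x k ≡ d y k)
  (d-sym : ∀ x y → d x y ≡ d y x)
  (far : ∀ {i j v w} → i ≢ j →
    dₗ (LexVertices.from G H (i , v)) (LexVertices.from G H (j , w)) ≡ d i j)
  (near : ∀ {i v w} →
    dₗ (LexVertices.from G H (i , v)) (LexVertices.from G H (i , w)) ≡ dist₂ (H i) v w)
  where

  open LexVertices G H

  Family : Set
  Family = ∀ i → Subset (order (H i))

  -- `cross` mentions no vertices of the copies, since a vertex of a third copy sees each of them at
  -- a single distance.
  record IsGenerator (F : Family) : Set where
    field
      local : ∀ i → LocalAdjGenerator (H i) (F i)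
      cross : ∀ {i j} → Adj G i j → ¬ Undominated (H i) (F i) → ¬ Undominated (H j) (F j) →
              ∃ λ k → k ≢ i × k ≢ j × Nonempty (F k) × d k i ≢ d k j

  open IsGenerator
  open TwinChoice c
  open Twins G
  open TwinChoices G H c

  fibres : Subset (order L) → Family
  fibres S i = Vec.tabulate λ v → Vec.lookup S (from (i , v))

  total : Family → Subset (order L)
  total F = Vec.tabulate λ x → Vec.lookup (F (proj₁ (to x))) (proj₂ (to x))

  fibres∘total : ∀ F i → fibres (total F) i ≡ F i
  fibres∘total F i = trans
    (tabulate-cong λ v → trans (lookup∘tabulate _ (from (i , v)))
      (cong (λ (j , w) → Vec.lookup (F j) w) (to∘from (i , v))))
    (tabulate∘lookup (F i))

  ∣∣-fibres : ∀ S → ∣ S ∣ ≡ ∑ (λ i → ∣ fibres S i ∣)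
  ∣∣-fibres S = trans (cong ∣_∣ (sym (tabulate∘lookup S)))
    (∣tabulate∣-sum (order ∘ H) (Vec.lookup S))

  ∈-fibres⁺ : ∀ {S i v} → from (i , v) ∈ S → v ∈ fibres S i
  ∈-fibres⁺ {S} {i} {v} s∈S = lookup⇒[]= v (fibres S i)
    (trans (lookup∘tabulate (λ v → Vec.lookup S (from (i , v))) v) ([]=⇒lookup s∈S))

  ∈-fibres⁻ : ∀ {S i v} → v ∈ fibres S i → from (i , v) ∈ S
  ∈-fibres⁻ {S} {i} {v} s∈F = lookup⇒[]= (from (i , v)) S
    (trans (sym (lookup∘tabulate (λ v → Vec.lookup S (from (i , v))) v)) ([]=⇒lookup s∈F))

  Separated : Family → Σ (V G) (V ∘ H) → Σ (V G) (V ∘ H) → Set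
  Separated F p q = ∃ λ i → ∃ λ v → v ∈ F i × dₗ (from (i , v)) (from p) ≢ dₗ (from (i , v)) (from q)

  resolves⇒separated : ∀ {S} → Resolves L dₗ (Adj L) S → ∀ {p q} → LexAdj G H p q →
                       Separated (fibres S) p q
  resolves⇒separated {S} res {p} {q} e
    with res (from p) (from q) (subst₂ (LexAdj G H) (sym (to∘from p)) (sym (to∘from q)) e)
  ... | s , s∈S , s≠ = proj₁ (to s) , proj₂ (to s) ,
    ∈-fibres⁺ (subst (_∈ S) (sym (from∘to s)) s∈S) ,
    subst (λ s → dₗ s (from p) ≢ dₗ s (from q)) (sym (from∘to s)) s≠

  separated⇒resolves : ∀ {S} → (∀ {p q} → LexAdj G H p q → Separated (fibres S) p q) →
                       Resolves L dₗ (Adj L) S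
  separated⇒resolves sep x y e with sep e
  ... | i , v , v∈F , v≠ = from (i , v) , ∈-fibres⁻ v∈F ,
    subst₂ (λ x y → dₗ (from (i , v)) x ≢ dₗ (from (i , v)) y) (from∘to x) (from∘to y) v≠

  adj⇒≢ : ∀ {i j} → Adj G i j → i ≢ j
  adj⇒≢ e refl = Adj-irrefl G refl e

  separated⇒generator : ∀ {F} → (∀ {p q} → LexAdj G H p q → Separated F p q) → IsGenerator F
  separated⇒generator sep .local i v w e with sep (within e)
  ... | k , s , s∈F , s≠ with k ≟ i
  ... | yes refl = s , s∈F , λ eq → s≠ (trans near (trans eq (sym near)))
  -- A vertex of another copy is equally far from all of copy `i`.
  ... | no k≢i   = contradiction (trans (far k≢i) (sym (far k≢i))) s≠
  separated⇒generator {F} sep .cross {i} {j} e ¬ui ¬uj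
    with dominated (H i) ¬ui | dominated (H j) ¬uj
  -- The pair of dominating vertices is the critical one: every element of either fibre is at
  -- distance one from both, so the witness lies in a third copy.
  ... | v , domv | w , domw with sep {i , v} {j , w} (across e)
  ... | k , s , s∈F , s≠ with k ≟ i | k ≟ j
  ... | yes refl | _ = contradiction
    (trans near (trans (dist₂-adj (H i) (Adj-sym (H i) (domv s s∈F)))
      (sym (trans (far (adj⇒≢ e)) (d-adj e))))) s≠
  ... | no _ | yes refl = contradiction
    (trans (far (≢-sym (adj⇒≢ e))) (trans (d-adj (Adj-sym G e))
      (sym (trans near (dist₂-adj (H j) (Adj-sym (H j) (domw s s∈F))))))) s≠
  ... | no k≢i | no k≢j = k , k≢i , k≢j , (s , s∈F) ,
    λ eq → s≠ (trans (far k≢i) (trans eq (sym (far k≢j))))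

  -- An element of the fibre not adjacent to `v` is not at distance one from it, but is at distance
  -- one from all of copy `j`.
  undominated⇒separated : ∀ {F i j v w} → Adj G i j → Undominated (H i) (F i) →
                          Separated F (i , v) (j , w)
  undominated⇒separated {i = i} {v = v} e u with u v
  ... | b , b∈F , ¬e = i , b , b∈F , λ eq → ¬e (Adj-sym (H i) (dist₂≡1⇒adj (H i)
    (trans (sym near) (trans eq (trans (far (adj⇒≢ e)) (d-adj e))))))

  separated-sym : ∀ {F p q} → Separated F p q → Separated F q p
  separated-sym (i , v , v∈F , v≠) = i , v , v∈F , ≢-sym v≠

  generator⇒separated : ∀ {F} → IsGenerator F → ∀ {p q} → LexAdj G H p q → Separated F p q
  generator⇒separated gen (within {i} {v} {w} e) with gen .local i v w e
  ... | s , s∈F , s≠ = i , s , s∈F , λ eq → s≠ (trans (sym near) (trans eq near))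
  generator⇒separated {F} gen (across {i} {j} {v} {w} e)
    with undominated? (H i) (F i) | undominated? (H j) (F j)
  ... | yes u | _     = undominated⇒separated {F} e u
  ... | no _  | yes u = separated-sym {F} {j , w} {i , v} (undominated⇒separated {F} (Adj-sym G e) u)
  ... | no ¬u | no ¬u′ with gen .cross e ¬u ¬u′
  ... | k , k≢i , k≢j , (s , s∈F) , k≠ = k , s , s∈F ,
    λ eq → k≠ (trans (sym (far k≢i)) (trans eq (far k≢j)))

  fibres-generator : ∀ {S} → Resolves L dₗ (Adj L) S → IsGenerator (fibres S)
  fibres-generator {S} res = separated⇒generator (resolves⇒separated {S} res)

  total-resolves : ∀ {F} → IsGenerator F → Resolves L dₗ (Adj L) (total F)
  total-resolves {F} gen = separated⇒resolves {total F} λ e →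
    let i , v , v∈F , v≠ = generator⇒separated gen e
    in i , v , subst (v ∈_) (sym (fibres∘total F i)) v∈F , v≠

  ∣total∣ : ∀ F → ∣ total F ∣ ≡ ∑ (λ i → ∣ F i ∣)
  ∣total∣ F = trans (∣∣-fibres (total F)) (sum-cong-≗ λ i → cong ∣_∣ (fibres∘total F i))

  d-separating : ∀ {x y} → Adj G x y → d x x ≢ d x y
  d-separating e eq with () ← trans (sym d-self) (trans eq (d-adj e))

  d-twinsʳ : ∀ {x y k} → TrueTwins G x y → k ≢ x → k ≢ y → d k x ≡ d k y
  d-twinsʳ t k≢x k≢y = trans (d-sym _ _) (trans (d-twins t k≢x k≢y) (d-sym _ _))

  -- Upper bound: from an ℛ-generator to a generator of the product.

  module Upper {A : Subset (order G)} (gen : ℛ-Generator G H c d A) where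

    Boosted : Pred (V G) 0ℓ
    Boosted i = i ∈ A ⊎ I′ G H c i

    boosted? : Decidable Boosted
    boosted? i = (i ∈? A) ⊎-dec I′? i

    -- Undominated fibres are free outside `I` and cost one extra element at boosted vertices; the
    -- remaining fibres are plain bases.
    Piece : ∀ i → Dec (Boosted i) → Subset (order (H i)) → Set
    Piece i b? B = LocalAdjGenerator (H i) B × ∣ B ∣ ≤ adimₗ (H i) + indicator (does b?) ×
                   (Boosted i ⊎ ¬ I G H i → Undominated (H i) B)

    boosted⇒I : ∀ {i} → Boosted i → I G H i
    boosted⇒I (inj₁ i∈A)       = proj₁ (proj₁ gen _ i∈A)
    boosted⇒I (inj₂ (i∈I , _)) = i∈I

    -- The decisions are arguments because with would normalise adimₗ and Class𝒢 at great cost.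
    piece : ∀ i (b? : Dec (Boosted i)) → Dec (I G H i) → ∃ (Piece i b?)
    piece i (yes b) _ =
      let B , local , size , u = 𝒢-undominated (H i) (boosted⇒I b)
      in B , local , size , λ _ → u
    piece i (no ¬b) (yes i∈I) =
      let B , local , size = basis (H i)
      in B , local , ℕ.≤-reflexive (trans size (sym (ℕ.+-identityʳ _))) ,
         [ (λ b → contradiction b ¬b) , contradiction i∈I ]′
    piece i (no ¬b) (no i∉I) =
      let B , (local , size) , u = ∉𝒢-undominated (H i) i∉I
      in B , local , ℕ.≤-reflexive (trans size (sym (ℕ.+-identityʳ _))) , λ _ → u

    abstract
      pieces : ∀ i → ∃ (Piece i (boosted? i))
      pieces i = piece i (boosted? i) (class𝒢? (H i))

    F : Family
    F i = proj₁ (pieces i)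

    F-local : ∀ i → LocalAdjGenerator (H i) (F i)
    F-local i = proj₁ (proj₂ (pieces i))

    F-undominated : ∀ {i} → Boosted i ⊎ ¬ I G H i → Undominated (H i) (F i)
    F-undominated {i} = proj₂ (proj₂ (proj₂ (pieces i)))

    F-nonempty : ∀ {i} → Boosted i ⊎ ¬ I G H i → Nonempty (F i)
    F-nonempty {i} b = undominated⇒nonempty (H i) (F-undominated b)

    dominated⇒X-E : ∀ {i} → ¬ Undominated (H i) (F i) → X-E G H c i × i ∉ A
    dominated⇒X-E {i} ¬u =
      (decidable-stable (class𝒢? (H i)) (¬u ∘ F-undominated ∘ inj₂) ,
       ¬u ∘ F-undominated ∘ inj₁ ∘ inj₂) ,
      ¬u ∘ F-undominated ∘ inj₁ ∘ inj₁

    ≢-twin : ∀ {i u u′} → X-E G H c i → X-E G H c u → u ≢ i → TrueTwins G u u′ → u′ ≢ i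
    ≢-twin i∈X u∈X u≢i t refl = u≢i (X-E-twins u∈X i∈X t)

    Witness : V G → V G → Pred (V G) 0ℓ
    Witness i j k = k ≢ i × k ≢ j × Nonempty (F k) × d k i ≢ d k j

    Visible : V G → V G → Pred (V G) 0ℓ
    Visible i j u = ¬ V-E G H u × u ≢ i × u ≢ j × d u i ≢ d u j

    visible? : ∀ i j → Decidable (Visible i j)
    visible? i j u = ¬? (V-E? u) ×-dec ¬? (u ≟ i) ×-dec ¬? (u ≟ j) ×-dec
                     ¬? (≡-dec ℕ._≟_ (d u i) (d u j))

    -- A vertex of `X-E` with a proper twin is the chosen one, so its twins in `I` are boosted;
    -- twins outside `I` have undominated fibres anyway.
    twin-nonempty : ∀ {u u′} → X-E G H c u → u ≢ u′ → TrueTwins G u u′ →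
                    Dec (I G H u′) → Nonempty (F u′)
    twin-nonempty u∈X u≢u′ t (no u′∉I)  = F-nonempty (inj₂ u′∉I)
    twin-nonempty u∈X u≢u′ t (yes u′∈I) =
      F-nonempty (inj₁ (inj₂ (unchosen u′∈I (twins-sym t) (≢-sym u≢u′) (proj₁ u∈X)
        (X-E-chosen u∈X (_ , u≢u′ , t)))))

    -- If the piece of u is empty, then u is the chosen vertex of its class, and a true
    -- twin of u does the job.
    witness : ∀ {i j u} → X-E G H c i → X-E G H c j → Visible i j u →
              Dec (Nonempty (F u)) → Dec (T G u) → ∃ (Witness i j)
    witness i∈X j∈X (_ , u≢i , u≢j , u≠) (yes ne) _ = _ , u≢i , u≢j , ne , u≠
    witness {u = u} i∈X j∈X (u∉V-E , _) (no ¬ne) (no u∉T) = contradiction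
      (generator⇒nonempty (H u) (λ none → u∉V-E (u∉T , none)) (F-local u)) ¬ne
    witness {i} {j} {u} i∈X j∈X (_ , u≢i , u≢j , u≠) (no ¬ne) (yes (u′ , u≢u′ , t)) =
      u′ , u′≢i , u′≢j , twin-nonempty u∈X u≢u′ t (class𝒢? (H u′)) ,
      λ eq → u≠ (trans (d-twins t (≢-sym u≢i) (≢-sym u′≢i))
        (trans eq (sym (d-twins t (≢-sym u≢j) (≢-sym u′≢j)))))
      where
      u∈X : X-E G H c u
      u∈X = proj₁ (dominated⇒X-E (¬ne ∘ undominated⇒nonempty (H u)))
      u′≢i : u′ ≢ i
      u′≢i = ≢-twin i∈X u∈X u≢i t
      u′≢j : u′ ≢ j
      u′≢j = ≢-twin j∈X u∈X u≢j t

    -- If some `u` is visible, it or a twin of it serves. Otherwise `i` and `j` are related by `ℛ`,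
    -- and the vertex of `A` separating them has a nonempty fibre because it is boosted.
    cross-witness : ∀ {i j} → Adj G i j → X-E G H c i × i ∉ A → X-E G H c j × j ∉ A →
                    Dec (∃ (Visible i j)) → ∃ (Witness i j)
    cross-witness e (i∈X , _) (j∈X , _) (yes (u , vis)) =
      witness i∈X j∈X vis (nonempty? (F u)) (T? G u)
    cross-witness {i} {j} e (i∈X , i∉A) (j∈X , j∉A) (no none) =
      let a , a∈A , a≠ = proj₂ gen i j (i∈X , j∈X , e , same)
      in a , (λ a≡i → i∉A (subst (_∈ A) a≡i a∈A)) , (λ a≡j → j∉A (subst (_∈ A) a≡j a∈A)) ,
         F-nonempty (inj₁ (inj₁ a∈A)) , a≠
      where
      same : ∀ u → ¬ V-E G H u → u ≢ i → u ≢ j → d u i ≡ d u j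
      same u u∉V-E u≢i u≢j = decidable-stable (≡-dec ℕ._≟_ (d u i) (d u j))
        λ u≠ → none (u , u∉V-E , u≢i , u≢j , u≠)

    F-generator : IsGenerator F
    F-generator .local = F-local
    F-generator .cross {i} {j} e ¬ui ¬uj =
      cross-witness e (dominated⇒X-E ¬ui) (dominated⇒X-E ¬uj) (any? (visible? i j))

    ∣F∣ : ∣ total F ∣ ≤ offset + ∣ A ∣
    ∣F∣ = begin
      ∣ total F ∣                                              ≡⟨ ∣total∣ F ⟩
      ∑ (λ i → ∣ F i ∣)                                       ≤⟨ ∑-mono-≤ (λ i → proj₁ (proj₂ (proj₂ (pieces i)))) ⟩
      ∑ (λ i → adimₗ (H i) + indicator (does (boosted? i)))   ≡⟨ offset+ (_∈? A) (λ x → proj₂ ∘ proj₁ gen x) ⟨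
      offset + ∣ ⟦ _∈? A ⟧ ∣                                   ≤⟨ ℕ.+-monoʳ-≤ offset (p⊆q⇒∣p∣≤∣q∣ (∈⟦⟧⇒ (_∈? A))) ⟩
      offset + ∣ A ∣                                           ∎
      where open ℕ.≤-Reasoning

  upper : ∀ {A} → ℛ-Generator G H c d A →
          ∃ λ S → Resolves L dₗ (Adj L) S × ∣ S ∣ ≤ offset + ∣ A ∣
  upper gen = total F , total-resolves F-generator , ∣F∣
    where open Upper gen

  -- Lower bound: from a generator of the product to an ℛ-generator.

  module Lower {F : Family} (gen : IsGenerator F) where

    Good : Pred (V G) 0ℓ
    Good x = Undominated (H x) (F x)

    good? : Decidable Good
    good? x = undominated? (H x) (F x)

    GoodI : Pred (V G) 0ℓ
    GoodI x = I G H x × Good x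

    abstract
      goodI? : Decidable GoodI
      goodI? x = class𝒢? (H x) ×-dec good? x

    -- The ℛ-generator to be extracted. If some `y` in ⋃ⱼ I′ⱼ with chosen vertex `x` has a dominated
    -- fibre, the extra element at `x` pays for `y` and must not be counted again for `x`.
    Kept : Pred (V G) 0ℓ
    Kept x = X-E G H c x × Good x × (∀ y → I′ G H c y → chosen y ≡ x → Good y)

    abstract
      kept? : Decidable Kept
      kept? x = X-E? G H c x ×-dec good? x ×-dec
                all? λ y → I′? y →-dec (chosen y ≟ x →-dec good? y)

    -- If both fibres were dominated, `cross` would require a third vertex at different distances
    -- from two twins.
    twins-good : ∀ {x y} → TrueTwins G x y → x ≢ y → ¬ Good x → Good y
    twins-good {x} {y} t x≢y ¬gx = decidable-stable (good? y) λ ¬gy →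
      let k , k≢x , k≢y , _ , k≠ = gen .cross (twins-adj x≢y t) ¬gx ¬gy
      in k≠ (d-twinsʳ t k≢x k≢y)

    -- The vertex of I at which the extra element paid for x is found; the price of a
    -- spared x ∈ I′ has been paid by its chosen twin, which is then not kept.
    data Charge (x : V G) : V G → Set where
      self : Good x → Kept x ⊎ I′ G H c x → Charge x x
      twin : ¬ Good x → I′ G H c x → Charge x (chosen x)

    kept⊎I′⇒I : ∀ {x} → Kept x ⊎ I′ G H c x → I G H x
    kept⊎I′⇒I (inj₁ ((x∈I , _) , _)) = x∈I
    kept⊎I′⇒I (inj₂ (x∈I , _))       = x∈I

    charge : ∀ x → Kept x ⊎ I′ G H c x → Dec (Good x) → ∃ λ y → GoodI y × Charge x y
    charge x k (yes g)                  = x , (kept⊎I′⇒I k , g) , self g k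
    charge x (inj₁ (_ , g , _)) (no ¬g) = contradiction g ¬g
    charge x (inj₂ x∈I′@(x∈I , x∈T , x≢)) (no ¬g) =
      chosen x , (chosen-I x∈I x∈T , twins-good (chosen-twin x∈I x∈T) x≢ ¬g) , twin ¬g x∈I′

    -- A kept `x` has only good vertices assigned to it, and a member of ⋃ⱼ I′ⱼ is never a chosen
    -- vertex.
    self≢twin : ∀ {x x′} → Good x → Kept x ⊎ I′ G H c x → ¬ Good x′ → I′ G H c x′ → x ≢ chosen x′
    self≢twin _ (inj₁ (_ , _ , kept)) ¬g x′∈I′ refl = ¬g (kept _ x′∈I′ refl)
    self≢twin _ (inj₂ (x∈I , x∈T , x≢)) _ (x′∈I , x′∈T , _) refl =
      x≢ (chosen-class x′∈I x′∈T x∈I x∈T (chosen-twin x′∈I x′∈T))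

    charge-injective : ∀ {x x′ y y′} → Charge x y → Charge x′ y′ → y ≡ y′ → x ≡ x′
    charge-injective (self _ _)  (self _ _)   eq = eq
    charge-injective (self g k)  (twin ¬g x′) eq = contradiction eq (self≢twin g k ¬g x′)
    charge-injective (twin ¬g x) (self g k)   eq = contradiction (sym eq) (self≢twin g k ¬g x)
    -- Both are twins of one chosen vertex, and a twin class has at most one dominated fibre.
    charge-injective {x} {x′} (twin ¬g (x∈I , x∈T , _)) (twin ¬g′ (x′∈I , x′∈T , _)) eq =
      decidable-stable (x ≟ x′) λ x≢x′ → ¬g′ (twins-good
        (twins-trans (chosen-twin x∈I x∈T)
          (subst (λ y → TrueTwins G y x′) (sym eq) (twins-sym (chosen-twin x′∈I x′∈T))))
        x≢x′ ¬g)

    size-piece : ∀ i (g? : Dec (GoodI i)) → adimₗ (H i) + indicator (does g?) ≤ ∣ F i ∣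
    size-piece i (yes (i∈I , g)) = ℕ.≤-trans (ℕ.≤-reflexive (ℕ.+-comm (adimₗ (H i)) 1))
                                     (𝒢-undominated-size (H i) i∈I (gen .local i) g)
    size-piece i (no _)          = ℕ.≤-trans (ℕ.≤-reflexive (ℕ.+-identityʳ _))
                                     (adimₗ-≤ (H i) (gen .local i))

    kept⇒∉I′ : ∀ x → Kept x → ¬ I′ G H c x
    kept⇒∉I′ x ((_ , x∉I′) , _) = x∉I′

    -- Charging injects the kept vertices and ⋃ⱼ I′ⱼ into `GoodI`, and at each vertex of `GoodI` the
    -- fibre exceeds `adimₗ`.
    size : offset + ∣ ⟦ kept? ⟧ ∣ ≤ ∑ (λ i → ∣ F i ∣)
    size = begin
      offset + ∣ ⟦ kept? ⟧ ∣
        ≡⟨ offset+ kept? kept⇒∉I′ ⟩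
      ∑ (λ i → adimₗ (H i) + indicator (does (kept? i ⊎-dec I′? i)))
        ≡⟨ ∑-distrib-+ (adimₗ ∘ H) (λ i → indicator (does (kept? i ⊎-dec I′? i))) ⟩
      ∑ (adimₗ ∘ H) + ∑ (λ i → indicator (does (kept? i ⊎-dec I′? i)))
        ≡⟨ cong (∑ (adimₗ ∘ H) +_) (∣tabulate∣≡∑ (λ i → does (kept? i ⊎-dec I′? i))) ⟨
      ∑ (adimₗ ∘ H) + ∣ ⟦ kept⊎I′? ⟧ ∣
        ≤⟨ ℕ.+-monoʳ-≤ (∑ (adimₗ ∘ H)) (∣∣-injection ⟦ kept⊎I′? ⟧ ⟦ goodI? ⟧ Charge
             image λ r r′ → charge-injective r r′ refl) ⟩
      ∑ (adimₗ ∘ H) + ∣ ⟦ goodI? ⟧ ∣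
        ≡⟨ cong (∑ (adimₗ ∘ H) +_) (∣tabulate∣≡∑ (λ i → does (goodI? i))) ⟩
      ∑ (adimₗ ∘ H) + ∑ (λ i → indicator (does (goodI? i)))
        ≡⟨ ∑-distrib-+ (adimₗ ∘ H) (λ i → indicator (does (goodI? i))) ⟨
      ∑ (λ i → adimₗ (H i) + indicator (does (goodI? i)))
        ≤⟨ ∑-mono-≤ (λ i → size-piece i (goodI? i)) ⟩
      ∑ (λ i → ∣ F i ∣) ∎
      where
      open ℕ.≤-Reasoning
      kept⊎I′? : Decidable (λ x → Kept x ⊎ I′ G H c x)
      kept⊎I′? x = kept? x ⊎-dec I′? x
      image : ∀ x → x ∈ ⟦ kept⊎I′? ⟧ → ∃ λ y → y ∈ ⟦ goodI? ⟧ × Charge x y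
      image x x∈ = let y , g , r = charge x (∈⟦⟧⇒ kept⊎I′? x∈) (good? x)
                   in y , ⇒∈⟦⟧ goodI? g , r

    Displaced : V G → Pred (V G) 0ℓ
    Displaced x y = I′ G H c y × chosen y ≡ x × ¬ Good y

    displaced? : ∀ x → Decidable (Displaced x)
    displaced? x y = I′? y ×-dec (chosen y ≟ x) ×-dec ¬? (good? y)

    -- A vertex of `X-E` fails to be kept either through its own dominated fibre or through that of
    -- a twin charged to it.
    bad-twin : ∀ {x} → X-E G H c x → ¬ Kept x → Dec (Good x) → Dec (∃ (Displaced x)) →
               ∃ λ x̄ → TrueTwins G x x̄ × ¬ Good x̄
    bad-twin {x} x∈X ¬kept (no ¬g) _ = x , twins-refl , ¬g
    bad-twin {x} x∈X ¬kept (yes g) (yes (y , (y∈I , y∈T , _) , eq , ¬gy)) =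
      y , subst (λ x → TrueTwins G x y) eq (twins-sym (chosen-twin y∈I y∈T)) , ¬gy
    bad-twin {x} x∈X ¬kept (yes g) (no none) = contradiction
      (x∈X , g , λ y y∈I′ eq → decidable-stable (good? y) λ ¬gy → none (y , y∈I′ , eq , ¬gy))
      ¬kept

    -- An edgeless copy is in 𝒢 and any nonempty fibre of it is undominated. Outside `T` the vertex
    -- is neither in ⋃ⱼ I′ⱼ nor the chosen twin of a member of it.
    ∈V-E⇒kept : ∀ {k} → V-E G H k → Nonempty (F k) → Kept k
    ∈V-E⇒kept {k} (k∉T , none) ne =
      (edgeless⇒𝒢 (H k) none , k∉T ∘ proj₁ ∘ proj₂) ,
      edgeless⇒undominated (H k) none ne ,
      λ y y∈I′ eq → contradiction (subst (T G) eq (chosen-T y∈I′)) k∉T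
      where
      chosen-T : ∀ {y} → I′ G H c y → T G (chosen y)
      chosen-T {y} (y∈I , y∈T , y≢) = y , ≢-sym y≢ , twins-sym (chosen-twin y∈I y∈T)

    twins-cross-adj : ∀ {x y x̄ ȳ} → TrueTwins G x x̄ → TrueTwins G y ȳ → Adj G x y →
                      x̄ ≢ ȳ → Adj G x̄ ȳ
    twins-cross-adj t t′ e x̄≢ȳ = closed-adj x̄≢ȳ
      (closed-sym (twins-closed t′ (closed-sym (twins-closed t (inj₂ e)))))

    -- If `k` were `x`, it would be adjacent to its twin `x̄` and also to `ȳ`, hence at distance one
    -- from both.
    ≢-rep : ∀ {x y x̄ ȳ k} → TrueTwins G x x̄ → TrueTwins G y ȳ → Adj G x y →
            k ≢ x̄ → k ≢ ȳ → d k x̄ ≢ d k ȳ → k ≢ x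
    ≢-rep t t′ e k≢x̄ k≢ȳ k≠ refl = k≠ (trans (d-adj (twins-adj k≢x̄ t))
      (sym (d-adj (twins-cross-adj twins-refl t′ e k≢ȳ))))

    -- `cross` applied to the dominated twins `x̄` and `ȳ` yields `k` with a nonempty fibre. Twins
    -- have equal distances to `k`, so `k` separates `x` and `y` too.
    kept-separates : ∀ {x y x̄ ȳ} → ℛ G H c d x y → TrueTwins G x x̄ → TrueTwins G y ȳ →
                     ¬ Good x̄ → ¬ Good ȳ → ∃ λ k → Kept k × d k x ≢ d k y
    kept-separates {x} {y} {x̄} {ȳ} (x∈X , y∈X , e , same) t t′ ¬gx̄ ¬gȳ =
      k , ∈V-E⇒kept k∈V-E ne , k≠′
      where
      x̄≢ȳ : x̄ ≢ ȳ
      -- Otherwise `x` and `y` would be twins in `X-E`, hence equal, although they are adjacent.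
      x̄≢ȳ eq = adj⇒≢ e (X-E-twins x∈X y∈X
        (twins-trans t (twins-sym (subst (TrueTwins G y) (sym eq) t′))))
      apart : ∃ λ k → k ≢ x̄ × k ≢ ȳ × Nonempty (F k) × d k x̄ ≢ d k ȳ
      apart = gen .cross (twins-cross-adj t t′ e x̄≢ȳ) ¬gx̄ ¬gȳ
      k : V G
      k = proj₁ apart
      k≢x̄ : k ≢ x̄
      k≢x̄ = proj₁ (proj₂ apart)
      k≢ȳ : k ≢ ȳ
      k≢ȳ = proj₁ (proj₂ (proj₂ apart))
      ne : Nonempty (F k)
      ne = proj₁ (proj₂ (proj₂ (proj₂ apart)))
      k≠ : d k x̄ ≢ d k ȳ
      k≠ = proj₂ (proj₂ (proj₂ (proj₂ apart)))
      k≢x : k ≢ x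
      k≢x = ≢-rep t t′ e k≢x̄ k≢ȳ k≠
      k≢y : k ≢ y
      k≢y = ≢-rep t′ t (Adj-sym G e) k≢ȳ k≢x̄ (≢-sym k≠)
      k≠′ : d k x ≢ d k y
      k≠′ eq = k≠ (trans (sym (d-twinsʳ t k≢x k≢x̄)) (trans eq (d-twinsʳ t′ k≢y k≢ȳ)))
      k∈V-E : V-E G H k
      -- By `ℛ`, no vertex outside `V-E` other than `x` and `y` separates them.
      k∈V-E = decidable-stable (V-E? k) λ k∉V-E → k≠′ (same k k∉V-E k≢x k≢y)

    kept-resolves : ∀ {x y} → ℛ G H c d x y → Dec (Kept x) → Dec (Kept y) →
                    ∃ λ k → Kept k × d k x ≢ d k y
    kept-resolves (_ , _ , e , _) (yes kx) _  = _ , kx , d-separating e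
    kept-resolves (_ , _ , e , _) (no _) (yes ky) =
      _ , ky , ≢-sym (d-separating (Adj-sym G e))
    kept-resolves {x} {y} r@(x∈X , y∈X , _) (no ¬kx) (no ¬ky) =
      let x̄ , t  , ¬gx̄ = bad-twin x∈X ¬kx (good? x) (any? (displaced? x))
          ȳ , t′ , ¬gȳ = bad-twin y∈X ¬ky (good? y) (any? (displaced? y))
      in kept-separates r t t′ ¬gx̄ ¬gȳ

    kept-generator : ℛ-Generator G H c d ⟦ kept? ⟧
    kept-generator = (λ a a∈ → proj₁ (∈⟦⟧⇒ kept? a∈)) , λ x y r →
      let k , kept , k≠ = kept-resolves r (kept? x) (kept? y)
      in k , ⇒∈⟦⟧ kept? kept , k≠

  lower : ∀ {S} → Resolves L dₗ (Adj L) S →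
          ∃ λ A → ℛ-Generator G H c d A × offset + ∣ A ∣ ≤ ∣ S ∣
  lower {S} res = ⟦ kept? ⟧ , kept-generator ,
    ℕ.≤-trans size (ℕ.≤-reflexive (sym (∣∣-fibres S)))
    where open Lower (fibres-generator {S} res)

  minimum : ∀ {k r} → Minimum (HasSize (Resolves L dₗ (Adj L))) k →
            Minimum (HasSize (ℛ-Generator G H c d)) r → k ≡ offset + r
  minimum minL minℛ = Minimum-shift offset minL minℛ lower upper

-- Comparison of the two metrics.

theorem8 : (G : Graph) → Connected G → 2 ≤ order G →
    (H : V G → Graph) (c : TwinChoice G H) →
    (dimₗ (lexProduct G H) ≡ adimₗ (lexProduct G H)) ⇔ (ϱ G H c ≡ ϱ′ G H c)
theorem8 G conn 2≤n H c = mk⇔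
  (λ eq → ℕ.+-cancelˡ-≡ offset _ _ (trans (sym dimₗ≡) (trans eq adimₗ≡)))
  (λ eq → trans dimₗ≡ (trans (cong (offset +_) eq) (sym adimₗ≡)))
  where
  open Twins G using (dist-twinsˡ)
  open LexDistance G conn 2≤n H
  L : Graph
  L = lexProduct G H
  module D = LexGenerators G H c (dist G) (dist L)
    (dist-refl G _) (dist-adj G) (dist-twinsˡ conn) (dist-sym G conn) dist-far dist-near
  module D₂ = LexGenerators G H c (dist₂ G) (dist₂ L)
    (cong min2 (dist-refl G _)) (dist₂-adj G)
    (λ t k≢x k≢y → cong min2 (dist-twinsˡ conn t k≢x k≢y))
    (λ x y → cong min2 (dist-sym G conn x y)) (cong min2 ∘ dist-far) dist₂-near
  open TwinChoices G H c using (offset)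
  dimₗ≡ : dimₗ L ≡ offset + ϱ G H c
  dimₗ≡ = D.minimum
    (minSize-minimum (resolves? L (dist L) (Adj? L)) (⊤ , λ x y e → x , ∈⊤ , dist-separating L e))
    (minSize-minimum (ℛ-generator? G H c (dist G)) (∃-ℛ-generator G H c (dist G) (dist-separating G)))
  adimₗ≡ : adimₗ L ≡ offset + ϱ′ G H c
  adimₗ≡ = D₂.minimum (adimₗ-minimum L)
    (minSize-minimum (ℛ-generator? G H c (dist₂ G)) (∃-ℛ-generator G H c (dist₂ G) (dist₂-separating G)))
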